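{- For all $n\ge1$, $$D_n^{\mathsf{cddes}}(-1)=\begin{cases}E_n,&\text{if } n\text{ is even},\\ 0,&\text{if } n\text{ is odd}.\end{cases}$$ Thus $D^{\mathsf{cddes}}(-1;x)=\sec(x)$ (as formal power series in $x$).
   Context: Let $\mathfrak{D}_n$ be the set of derangements of $[n]=\{1,\dots,n\}$, i.e. permutations $\pi=\pi_1\cdots\pi_n$ (one-line notation, $\pi_i=\pi(i)$) with $\pi_i\ne i$ for all $i$. For a permutation $\pi$ of $[n]$, the letter $\pi_i$ is a cyclic double descent if $i>\pi_i>\pi_{\pi_i}$; let $\mathsf{cddes}(\pi)$ be the number of cyclic double descents of $\pi$. Define $D_n^{\mathsf{cddes}}(t)=\sum_{\pi\in\mathfrak{D}_n}t^{\mathsf{cddes}(\pi)}$ and $D^{\mathsf{cddes}}(t;x)=1+\sum_{n=1}^\infty D_n^{\mathsf{cddes}}(t)\frac{x^n}{n!}$. The Euler numbers $E_n$ are defined by $\sum_{n=0}^\infty E_n\frac{x^n}{n!}=\sec(x)+\tan(x)$. -}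

module Defs where

open import Data.Fin.Base using (Fin; _>_)
open import Data.Fin.Properties using (all?; any?; _≟_; _<?_)
open import Data.Integer.Base using (+_; 1ℤ)
open import Data.List.Base
  using (List; [_]; foldr; map; filter; length; allFin; applyUpTo; cartesianProductWith)
open import Data.Nat.Base as ℕ using (ℕ; zero; suc; _∸_; _!)
open import Data.Nat.Properties using (_!≢0)
open import Data.Product.Base using (_×_; _,_)
open import Data.Rational.Base
  using (ℚ; 0ℚ; 1ℚ; NonZero; _+_; _*_; _-_; -_; _÷_; _/_; 1/_; +-*-rawSemiring; toℚᵘ)
open import Data.Rational.Properties
  using ( +-identityʳ; +-assoc; +-comm; +-inverseˡ; *-assoc; *-comm; *-identityʳ; *-inverseˡ
        ; toℚᵘ-injective; toℚᵘ-homo-*; toℚᵘ-fromℚᵘ)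
import Data.Rational.Unnormalised.Base as ℚᵘ
import Data.Rational.Unnormalised.Properties as ℚᵘ
open import Data.Vec.Base using (Vec; []; _∷_; lookup)
open import Function.Base using (_∘_)
open import Function.Consequences.Propositional
  using (strictlySurjective⇒surjective; surjective⇒strictlySurjective)
open import Function.Definitions using (Injective; Surjective; Bijective)
open import Relation.Binary.PropositionalEquality
  using (_≡_; _≢_; _≗_; cong; module ≡-Reasoning)
open import Relation.Nullary.Decidable using (Dec; map′; _×-dec_; _→-dec_; ¬?)
open import Algebra.Definitions.RawSemiring +-*-rawSemiring using (_^_)

infixl 6 _⊕_
infixl 7 _⊛_ _⊘_

-- The letters 1, …, n are represented by Fin n in the same order, and a
-- permutation π of them by its one-line notation π₁ ⋯ πₙ.
Word : ℕ → Set
Word n = Vec (Fin n) n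

IsPermutation : ∀ {n} → Word n → Set
IsPermutation π = Bijective _≡_ _≡_ (lookup π)

IsDerangement : ∀ {n} → Word n → Set
IsDerangement π = IsPermutation π × (∀ i → lookup π i ≢ i)

isPermutation? : ∀ {n} (π : Word n) → Dec (IsPermutation π)
isPermutation? π = injective? ×-dec surjective?
  where
  injective? : Dec (Injective _≡_ _≡_ (lookup π))
  injective? = map′ (λ inj {i} {j} → inj i j) (λ inj i j → inj)
    (all? λ i → all? λ j → (lookup π i ≟ lookup π j) →-dec (i ≟ j))

  surjective? : Dec (Surjective _≡_ _≡_ (lookup π))
  surjective? = map′ strictlySurjective⇒surjective surjective⇒strictlySurjective
    (all? λ j → any? λ i → lookup π i ≟ j)

isDerangement? : ∀ {n} (π : Word n) → Dec (IsDerangement π)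
isDerangement? π = isPermutation? π ×-dec all? λ i → ¬? (lookup π i ≟ i)

words : ∀ {A : Set} → List A → (k : ℕ) → List (Vec A k)
words as zero    = [ [] ]
words as (suc k) = cartesianProductWith _∷_ as (words as k)

derangements : ∀ n → List (Word n)
derangements n = filter isDerangement? (words (allFin n) n)

-- The letter πᵢ is recorded by its position i.
IsCyclicDoubleDescent : ∀ {n} → Word n → Fin n → Set
IsCyclicDoubleDescent π i = i > lookup π i × lookup π i > lookup π (lookup π i)

isCyclicDoubleDescent? : ∀ {n} (π : Word n) i → Dec (IsCyclicDoubleDescent π i)
isCyclicDoubleDescent? π i =
  (lookup π i <? i) ×-dec (lookup π (lookup π i) <? lookup π i)

cddes : ∀ {n} → Word n → ℕ
cddes {n} π = length (filter (isCyclicDoubleDescent? π) (allFin n))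

sum : List ℚ → ℚ
sum = foldr _+_ 0ℚ

-- The polynomial Dₙ(t), given by its values at rational t.
D : ℕ → ℚ → ℚ
D n t = sum (map (λ π → t ^ cddes π) (derangements n))

-- Formal power series over ℚ, as coefficient sequences.
Series : Set
Series = ℕ → ℚ

_⊕_ : Series → Series → Series
(f ⊕ g) n = f n + g n

_⊛_ : Series → Series → Series
(f ⊛ g) n = sum (applyUpTo (λ k → f k * g (n ∸ k)) (suc n))

𝟙 : Series
𝟙 zero    = 1ℚ
𝟙 (suc n) = 0ℚ

-- Long division: with c = f₀ / g₀, f / g = c + x · (((f - c g) / x) / g).
_⊘_ : (f g : Series) .{{_ : NonZero (g 0)}} → Series
(f ⊘ g) zero    = f 0 ÷ g 0
(f ⊘ g) (suc n) = ((λ k → f (suc k) - (f 0 ÷ g 0) * g (suc k)) ⊘ g) n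

⊘-⊛ : ∀ f g .{{_ : NonZero (g 0)}} → (f ⊘ g) ⊛ g ≗ f
⊘-⊛ f g zero = begin
  f 0 * 1/ g 0 * g 0 + 0ℚ  ≡⟨ +-identityʳ _ ⟩
  f 0 * 1/ g 0 * g 0       ≡⟨ *-assoc (f 0) (1/ g 0) (g 0) ⟩
  f 0 * (1/ g 0 * g 0)     ≡⟨ cong (f 0 *_) (*-inverseˡ (g 0)) ⟩
  f 0 * 1ℚ                 ≡⟨ *-identityʳ (f 0) ⟩
  f 0                      ∎
  where open ≡-Reasoning
⊘-⊛ f g (suc n) = begin
  b + ((r ⊘ g) ⊛ g) n      ≡⟨ cong (λ z → b + z) (⊘-⊛ r g n) ⟩
  b + (f (suc n) - b)      ≡⟨ +-comm b _ ⟩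
  f (suc n) - b + b        ≡⟨ +-assoc (f (suc n)) (- b) b ⟩
  f (suc n) + (- b + b)    ≡⟨ cong (λ z → f (suc n) + z) (+-inverseˡ b) ⟩
  f (suc n) + 0ℚ           ≡⟨ +-identityʳ _ ⟩
  f (suc n)                ∎
  where
  open ≡-Reasoning
  b = (f 0 ÷ g 0) * g (suc n)
  r : Series
  r k = f (suc k) - (f 0 ÷ g 0) * g (suc k)

1/_! : ℕ → ℚ
1/ n ! = (1ℤ / (n !)) {{n !≢0}}

egf : (ℕ → ℚ) → Series
egf a n = a n * 1/ n !

-- The n-th derivatives of cos and sin at 0: 1, 0, -1, 0, … and 0, 1, 0, -1, …
cos⁽_⁾0 sin⁽_⁾0 : ℕ → ℚ
cos⁽ zero ⁾0  = 1ℚ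
cos⁽ suc n ⁾0 = - sin⁽ n ⁾0
sin⁽ zero ⁾0  = 0ℚ
sin⁽ suc n ⁾0 = cos⁽ n ⁾0

cos sin sec tan : Series
cos = egf cos⁽_⁾0
sin = egf sin⁽_⁾0
sec = 𝟙 ⊘ cos
tan = sin ⊘ cos

E : ℕ → ℚ
E n = (sec ⊕ tan) n * (+ (n !) / 1)

m/1*1/m≡1 : ∀ m .{{_ : ℕ.NonZero m}} → (+ m / 1) * (1ℤ / m) ≡ 1ℚ
m/1*1/m≡1 m@(suc k) = toℚᵘ-injective (begin
  toℚᵘ ((+ m / 1) * (1ℤ / m))             ≈⟨ toℚᵘ-homo-* (+ m / 1) (1ℤ / m) ⟩
  toℚᵘ (+ m / 1) ℚᵘ.* toℚᵘ (1ℤ / m)       ≈⟨ ℚᵘ.*-cong (toℚᵘ-fromℚᵘ (ℚᵘ.mkℚᵘ (+ m) 0))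
                                                       (toℚᵘ-fromℚᵘ (ℚᵘ.mkℚᵘ 1ℤ k)) ⟩
  ℚᵘ.mkℚᵘ (+ m) 0 ℚᵘ.* ℚᵘ.mkℚᵘ 1ℤ k       ≈⟨ ℚᵘ.*-inverseʳ (ℚᵘ.mkℚᵘ (+ m) 0) ⟩
  ℚᵘ.1ℚᵘ                                   ∎)
  where open ℚᵘ.≃-Reasoning

egf-E : egf E ≗ sec ⊕ tan
egf-E n = begin
  (sec ⊕ tan) n * (+ (n !) / 1) * 1/ n !    ≡⟨ *-assoc ((sec ⊕ tan) n) (+ (n !) / 1) (1/ n !) ⟩
  (sec ⊕ tan) n * ((+ (n !) / 1) * 1/ n !)  ≡⟨ cong ((sec ⊕ tan) n *_) (m/1*1/m≡1 (n !) {{n !≢0}}) ⟩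
  (sec ⊕ tan) n * 1ℚ                        ≡⟨ *-identityʳ _ ⟩
  (sec ⊕ tan) n                             ∎
  where open ≡-Reasoning

D-egf : ℚ → Series
D-egf t = 𝟙 ⊕ egf positivePart
  where
  positivePart : ℕ → ℚ
  positivePart zero    = 0ℚ
  positivePart (suc n) = D (suc n) t

{-# OPTIONS --safe #-}
module Submission where

-- Build the permutations by inserting a new least letter into the cycles, and
-- let a double ascent, double descent, peak, valley and fixed point weigh
-- u + 1, u - 1, 1, 1 + u² and u, where δ is a derivation with δu = 1 + u².
-- From a permutation of weight w, the new letter as a fixed point gives u w;
-- put on an edge it becomes a valley and changes only the smaller end of the
-- edge, and over all edges these weights add up to δw by the Leibniz rule.
-- For u = tan x and δ = d/dx the total weight Sₙ thus obeys
-- Sₙ₊₁ = u Sₙ + δSₙ, as does sec⁽ⁿ⁾ / sec.  At x = 0 we have u = 0, where fixed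
-- points weigh 0 and a derangement weighs (-1) to the number of its double
-- descents.

open import Algebra.Bundles using (CommutativeRing)
import Algebra.Construct.Pointwise as Pointwise
import Algebra.Properties.CommutativeMonoid.Sum as CommutativeMonoidSum
import Algebra.Properties.CommutativeSemigroup as CommutativeSemigroupProperties
import Algebra.Properties.Group as GroupProperties
import Algebra.Properties.Semiring.Sum as SemiringSum
open import Data.Bool using (Bool; true; false; if_then_else_; _∧_)
open import Data.Fin using (Fin; zero; suc)
open import Data.Fin.Permutation as Perm
  using (Permutation′; _⟨$⟩ʳ_; _⟨$⟩ˡ_; inverseˡ; inverseʳ; transpose
        ; lift₀; lift₀-remove; remove; _∘ₚ_)
open import Data.Fin.Properties using (_≟_; _<?_; any?; suc-injective)
import Data.Integer as ℤ
import Data.Integer.Properties as ℤ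
open import Data.List as List
  using (List; []; _∷_; _++_; map; filter; length; foldr; allFin; cartesianProductWith)
open import Data.List.Membership.Propositional using (_∈_)
open import Data.List.Membership.Propositional.Properties
  using (∈-map⁺; ∈-filter⁺; ∈-filter⁻; ∈-allFin; ∈-cartesianProductWith⁺)
open import Data.List.Membership.Propositional.Properties.WithK using (unique∧set⇒bag)
open import Data.List.Relation.Binary.BagAndSetEquality using (∼bag⇒↭)
open import Data.List.Relation.Binary.Permutation.Propositional as ↭ using (_↭_)
open import Data.List.Relation.Binary.Permutation.Propositional.Properties using (map⁺)
open import Data.List.Relation.Unary.All using ([])
open import Data.List.Relation.Unary.AllPairs using ([]; _∷_)
open import Data.List.Relation.Unary.Any using (here)
open import Data.List.Relation.Unary.Unique.Propositional using (Unique)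
import Data.List.Relation.Unary.Unique.Propositional.Properties as Unique
import Data.List.Relation.Unary.Unique.Setoid as SetoidUnique
import Data.List.Relation.Unary.Unique.Setoid.Properties as SetoidUnique
open import Data.Nat as ℕ using (ℕ; zero; suc; _≥_; _!)
open import Data.Nat.Divisibility using (_∣_; _∤_; divides)
import Data.Nat.Properties as ℕ
open import Data.Product using (_×_; _,_; ∃; ∃₂; proj₁; proj₂)
import Data.Rational.Unnormalised as ℚᵘ
import Data.Rational.Unnormalised.Properties as ℚᵘ
open import Data.Sum using (_⊎_; inj₁; inj₂)
open import Data.Vec as Vec using (Vec; []; _∷_; lookup)
open import Data.Vec.Properties using (lookup∘tabulate; tabulate∘lookup; tabulate-cong; ∷-injective)
open import Function using (_∘_; id; mk⤖; mk⇔; Bijection)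
open import Function.Properties.Bijection using (⤖⇒↔)
open import Function.Properties.Inverse using (↔⇒⤖)
open import Level using (_⊔_; 0ℓ)
open import Relation.Binary using (Setoid)
open import Relation.Binary.PropositionalEquality as ≡ using (_≡_; _≢_; _≗_)
import Relation.Binary.Reasoning.Setoid as SetoidReasoning
open import Relation.Nullary using (¬_; Dec; does; yes; no; contradiction)
open import Relation.Nullary.Decidable using (dec-true; dec-false)

-- Insertion of a least letter

data Step : Set where
  rise level drop : Step

-- Recursion on both letters makes a comparison of shifted letters reduce to the comparison of the
-- original ones, so edges untouched by an insertion keep their step by computation.
step : ∀ {n} → Fin n → Fin n → Step
step zero    zero    = level
step zero    (suc y) = rise
step (suc x) zero    = drop
step (suc x) (suc y) = step x y

step-refl : ∀ {n} (x : Fin n) → step x x ≡ level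
step-refl zero    = ≡.refl
step-refl (suc x) = step-refl x

step-level : ∀ {n} (x y : Fin n) → step x y ≡ level → x ≡ y
step-level zero    zero    _ = ≡.refl
step-level (suc x) (suc y) p = ≡.cong suc (step-level x y p)

-- The steps of the edges into and out of y in the cycle diagram. Their pair tells whether y is a
-- double ascent, double descent, peak, valley or fixed point.
arrival departure : ∀ {n} → Permutation′ n → Fin n → Step
arrival   π y = step (π ⟨$⟩ˡ y) y
departure π y = step y (π ⟨$⟩ʳ y)

arrival-image : ∀ {n} (π : Permutation′ n) x → arrival π (π ⟨$⟩ʳ x) ≡ departure π x
arrival-image π x = ≡.cong (λ z → step z (π ⟨$⟩ʳ x)) (inverseˡ π)

-- The letters of π are shifted up; the new least letter 0 is a fixed point if
-- k = 0, and is put on the edge a → π(a) of the cycle diagram if k = a + 1.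
ins : ∀ {n} → Permutation′ n → Fin (suc n) → Permutation′ (suc n)
ins π k = transpose zero k ∘ₚ lift₀ π

permutations : ∀ n → List (Permutation′ n)
permutations zero    = Perm.id ∷ []
permutations (suc n) = cartesianProductWith ins (permutations n) (allFin (suc n))

departure-ins : ∀ {n} (π : Permutation′ n) a y →
  departure (ins π (suc a)) (suc y) ≡ (if does (y ≟ a) then drop else departure π y)
departure-ins π a y with does (y ≟ a)
... | true  = ≡.refl
... | false = ≡.refl

arrival-ins : ∀ {n} (π : Permutation′ n) a y →
  arrival (ins π (suc a)) (suc y) ≡ (if does (π ⟨$⟩ˡ y ≟ a) then rise else arrival π y)
arrival-ins π a y with does (π ⟨$⟩ˡ y ≟ a)
... | true  = ≡.refl
... | false = ≡.refl

-- Derivations of a commutative ring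

record IsDerivation {c ℓ} (R : CommutativeRing c ℓ)
                    (δ : CommutativeRing.Carrier R → CommutativeRing.Carrier R) : Set (c ⊔ ℓ) where
  open CommutativeRing R
  field
    δ-cong : ∀ {x y} → x ≈ y → δ x ≈ δ y
    δ-+    : ∀ x y → δ (x + y) ≈ δ x + δ y
    δ-*    : ∀ x y → δ (x * y) ≈ δ x * y + x * δ y

  open GroupProperties +-group using (identityʳ-unique)

  δ-0 : δ 0# ≈ 0#
  δ-0 = identityʳ-unique (δ 0#) (δ 0#) (trans (sym (δ-+ 0# 0#)) (δ-cong (+-identityˡ 0#)))

  δ-1 : δ 1# ≈ 0#
  δ-1 = identityʳ-unique (δ 1#) (δ 1#) (sym (trans (δ-cong (sym (*-identityˡ 1#)))
    (trans (δ-* 1# 1#) (+-cong (*-identityʳ _) (*-identityˡ _)))))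

  δ-neg1 : δ (- 1#) ≈ 0#
  δ-neg1 = trans (sym (+-identityˡ _)) (trans (+-congʳ (sym δ-1))
    (trans (sym (δ-+ 1# (- 1#))) (trans (δ-cong (-‿inverseʳ 1#)) δ-0)))

-- Weights of permutations and their behaviour under insertion

module Weights {c ℓ} (R : CommutativeRing c ℓ) where
  open CommutativeRing R hiding (zero)
  open SemiringSum semiring using (sum; sum-cong-≋; ∑-distrib-+; ∑-permute; *-distribˡ-sum)
  open CommutativeMonoidSum *-commutativeMonoid using ()
    renaming (sum to product; sum-cong-≋ to product-cong)
  open CommutativeSemigroupProperties *-commutativeSemigroup using (x∙yz≈y∙xz)
  open CommutativeSemigroupProperties +-commutativeSemigroup using (interchange)
  open SetoidReasoning setoid

  -- The factors a double ascent, double descent, peak, valley and fixed point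
  -- contribute; the remaining pairs of steps do not occur.
  weight : Carrier → Step → Step → Carrier
  weight u rise  rise  = u + 1#
  weight u drop  drop  = u + - 1#
  weight u rise  drop  = 1#
  weight u drop  rise  = 1# + u * u
  weight u level level = u
  weight u level rise  = 0#
  weight u level drop  = 0#
  weight u rise  level = 0#
  weight u drop  level = 0#

  letter : Carrier → ∀ {n} → Permutation′ n → Fin n → Carrier
  letter u π y = weight u (arrival π y) (departure π y)

  W : Carrier → ∀ {n} → Permutation′ n → Carrier
  W u π = product (letter u π)

  listSum : ∀ {a} {A : Set a} → List A → (A → Carrier) → Carrier
  listSum xs f = foldr _+_ 0# (map f xs)

  listSum-cong : ∀ {a} {A : Set a} (xs : List A) {f g : A → Carrier} →
                 (∀ x → f x ≈ g x) → listSum xs f ≈ listSum xs g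
  listSum-cong []       p = refl
  listSum-cong (x ∷ xs) p = +-cong (p x) (listSum-cong xs p)

  listSum-++ : ∀ {a} {A : Set a} (xs ys : List A) (f : A → Carrier) →
               listSum (xs ++ ys) f ≈ listSum xs f + listSum ys f
  listSum-++ []       ys f = sym (+-identityˡ _)
  listSum-++ (x ∷ xs) ys f = trans (+-congˡ (listSum-++ xs ys f)) (sym (+-assoc _ _ _))

  listSum-map : ∀ {a b} {A : Set a} {B : Set b} (h : A → B) (xs : List A) (f : B → Carrier) →
                listSum (map h xs) f ≈ listSum xs (f ∘ h)
  listSum-map h []       f = refl
  listSum-map h (x ∷ xs) f = +-congˡ (listSum-map h xs f)

  listSum-cartesianProductWith :
    ∀ {a b d} {A : Set a} {B : Set b} {D : Set d} (h : A → B → D) xs ys (f : D → Carrier) →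
    listSum (cartesianProductWith h xs ys) f ≈ listSum xs (λ x → listSum ys (f ∘ h x))
  listSum-cartesianProductWith h []       ys f = refl
  listSum-cartesianProductWith h (x ∷ xs) ys f =
    trans (listSum-++ (map (h x) ys) _ f)
          (+-cong (listSum-map (h x) ys f) (listSum-cartesianProductWith h xs ys f))

  listSum-tabulate : ∀ {a} {A : Set a} {n} (h : Fin n → A) (f : A → Carrier) →
                     listSum (List.tabulate h) f ≈ sum (f ∘ h)
  listSum-tabulate {n = zero}  h f = refl
  listSum-tabulate {n = suc n} h f = +-congˡ (listSum-tabulate (h ∘ suc) f)

  listSum-+ : ∀ {a} {A : Set a} (xs : List A) (f g : A → Carrier) →
              listSum xs (λ x → f x + g x) ≈ listSum xs f + listSum xs g
  listSum-+ []       f g = sym (+-identityˡ _)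
  listSum-+ (x ∷ xs) f g = trans (+-congˡ (listSum-+ xs f g)) (interchange _ _ _ _)

  listSum-*ˡ : ∀ {a} {A : Set a} c (xs : List A) (f : A → Carrier) →
               listSum xs (λ x → c * f x) ≈ c * listSum xs f
  listSum-*ˡ c []       f = sym (zeroʳ c)
  listSum-*ˡ c (x ∷ xs) f = trans (+-congˡ (listSum-*ˡ c xs f)) (sym (distribˡ c _ _))

  productExcept : ∀ {n} → (Fin n → Carrier) → Fin n → Carrier
  productExcept f zero    = product (f ∘ suc)
  productExcept f (suc i) = f zero * productExcept (f ∘ suc) i

  -- Replaces one factor without dividing by the old one, which may fail to be invertible.
  product-update : ∀ {n} (f g : Fin n → Carrier) i → (∀ j → j ≢ i → g j ≈ f j) →
                   product g ≈ g i * productExcept f i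
  product-update f g zero    p = *-congˡ (product-cong (λ j → p (suc j) λ ()))
  product-update f g (suc i) p = trans
    (*-cong (p zero λ ()) (product-update (f ∘ suc) (g ∘ suc) i
      (λ j j≢i → p (suc j) λ { ≡.refl → j≢i ≡.refl })))
    (x∙yz≈y∙xz _ _ _)

  -- The inserted letter splits an edge leaving y, an ascent or a loop …
  splitDeparture : Carrier → Step → Step → Carrier
  splitDeparture u i     rise  = weight u i drop
  splitDeparture u level level = 1#
  splitDeparture u _     _     = 0#

  -- … or a descent arriving at y.
  splitArrival : Carrier → Step → Step → Carrier
  splitArrival u drop o = weight u rise o
  splitArrival u _    _ = 0#

  splitDeparture-drop : ∀ {u} i → splitDeparture u i drop ≡ 0#
  splitDeparture-drop rise  = ≡.refl
  splitDeparture-drop level = ≡.refl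
  splitDeparture-drop drop  = ≡.refl

  module _ {δ : Carrier → Carrier} (isDerivation : IsDerivation R δ) where
    open IsDerivation isDerivation

    δ-product : ∀ {n} (f : Fin n → Carrier) →
                δ (product f) ≈ sum (λ i → δ (f i) * productExcept f i)
    δ-product {zero}  f = δ-1
    δ-product {suc n} f = begin
      δ (f zero * product (f ∘ suc))
        ≈⟨ δ-* _ _ ⟩
      δ (f zero) * product (f ∘ suc) + f zero * δ (product (f ∘ suc))
        ≈⟨ +-congˡ (*-congˡ (δ-product (f ∘ suc))) ⟩
      δ (f zero) * product (f ∘ suc) + f zero * sum (λ i → δ (f (suc i)) * productExcept (f ∘ suc) i)
        ≈⟨ +-congˡ (*-distribˡ-sum (f zero) (λ i → δ (f (suc i)) * productExcept (f ∘ suc) i)) ⟩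
      δ (f zero) * product (f ∘ suc) + sum (λ i → f zero * (δ (f (suc i)) * productExcept (f ∘ suc) i))
        ≈⟨ +-congˡ (sum-cong-≋ {n} (λ i → x∙yz≈y∙xz _ _ _)) ⟩
      δ (f zero) * product (f ∘ suc) + sum (λ i → δ (f (suc i)) * productExcept f (suc i)) ∎

    δ-listSum : ∀ {a} {A : Set a} (xs : List A) (f : A → Carrier) →
                δ (listSum xs f) ≈ listSum xs (δ ∘ f)
    δ-listSum []       f = δ-0
    δ-listSum (x ∷ xs) f = trans (δ-+ _ _) (+-congˡ (δ-listSum xs f))

    module _ {u : Carrier} (δu : δ u ≈ 1# + u * u) where

      -- This identity dictates the weights. Here 1 + u² stands for the new valley. Splitting the
      -- relevant edge turns a double ascent, a double descent or a fixed point into a peak of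
      -- weight 1. A valley is the smaller end of both its edges and becomes a double descent or a
      -- double ascent, matching 2u = (u - 1) + (u + 1). A peak is the smaller end of neither edge,
      -- and δ1 = 0.
      δ-weight : ∀ i o → δ (weight u i o) ≈
        (1# + u * u) * (splitDeparture u i o + splitArrival u i o)
      δ-weight rise  rise  = trans (δ-+ u 1#) (trans (+-cong δu δ-1) (trans (+-identityʳ _)
        (sym (trans (*-congˡ (+-identityʳ 1#)) (*-identityʳ _)))))
      δ-weight drop  drop  = trans (δ-+ u _) (trans (+-cong δu δ-neg1) (trans (+-identityʳ _)
        (sym (trans (*-congˡ (+-identityˡ 1#)) (*-identityʳ _)))))
      δ-weight level level = trans δu (sym (trans (*-congˡ (+-identityʳ 1#)) (*-identityʳ _)))
      δ-weight drop  rise  = begin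
        δ (1# + u * u)                     ≈⟨ δ-+ _ _ ⟩
        δ 1# + δ (u * u)                   ≈⟨ +-cong δ-1 (δ-* u u) ⟩
        0# + (δ u * u + u * δ u)           ≈⟨ +-identityˡ _ ⟩
        δ u * u + u * δ u                  ≈⟨ +-congˡ (*-comm u (δ u)) ⟩
        δ u * u + δ u * u                  ≈⟨ distribˡ (δ u) u u ⟨
        δ u * (u + u)                      ≈⟨ *-cong δu (sym (+-identityʳ _)) ⟩
        (1# + u * u) * (u + u + 0#)        ≈⟨ *-congˡ (+-congˡ (-‿inverseˡ 1#)) ⟨
        (1# + u * u) * (u + u + (- 1# + 1#))    ≈⟨ *-congˡ (interchange u u (- 1#) 1#) ⟩
        (1# + u * u) * (u + - 1# + (u + 1#))    ∎
      δ-weight rise  drop  = trans δ-1 (sym (trans (*-congˡ (+-identityʳ 0#)) (zeroʳ _)))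
      δ-weight level rise  = trans δ-0 (sym (trans (*-congˡ (+-identityʳ 0#)) (zeroʳ _)))
      δ-weight level drop  = trans δ-0 (sym (trans (*-congˡ (+-identityʳ 0#)) (zeroʳ _)))
      δ-weight rise  level = trans δ-0 (sym (trans (*-congˡ (+-identityʳ 0#)) (zeroʳ _)))
      δ-weight drop  level = trans δ-0 (sym (trans (*-congˡ (+-identityʳ 0#)) (zeroʳ _)))

      module _ {n} (π : Permutation′ n) where
        private
          f = letter u π
          departureTerm arrivalTerm : Fin n → Carrier
          departureTerm y = splitDeparture u (arrival π y) (departure π y) * productExcept f y
          arrivalTerm y = splitArrival u (arrival π y) (departure π y) * productExcept f y

          splitLetter : Fin n → Fin n → Carrier
          splitLetter a y = weight u (if does (π ⟨$⟩ˡ y ≟ a) then rise else arrival π y)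
                                     (if does (y ≟ a) then drop else departure π y)

        module _ (a : Fin n) where
          private
            b = π ⟨$⟩ʳ a

            newArrival newDeparture : Fin n → Step
            newArrival   y = if does (π ⟨$⟩ˡ y ≟ a) then rise else arrival π y
            newDeparture y = if does (y ≟ a) then drop else departure π y

          newArrival-image : newArrival b ≡ rise
          newArrival-image rewrite dec-true (π ⟨$⟩ˡ b ≟ a) (inverseˡ π) = ≡.refl

          newArrival-other : ∀ {y} → y ≢ b → newArrival y ≡ arrival π y
          newArrival-other {y} y≢b rewrite dec-false (π ⟨$⟩ˡ y ≟ a)
            (λ p → y≢b (≡.trans (≡.sym (inverseʳ π)) (≡.cong (π ⟨$⟩ʳ_) p))) = ≡.refl

          -- If the split edge was an ascent, its head b was already reached by a rise and is now
          -- reached by a rise from the new least letter. So only the tail a changes.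
          newArrival-rise : departure π a ≡ rise → ∀ y → newArrival y ≡ arrival π y
          newArrival-rise p y with y ≟ b
          ... | yes ≡.refl = ≡.trans newArrival-image (≡.sym (≡.trans (arrival-image π a) p))
          ... | no  y≢b    = newArrival-other y≢b

          newDeparture-source : newDeparture a ≡ drop
          newDeparture-source rewrite dec-true (a ≟ a) ≡.refl = ≡.refl

          newDeparture-other : ∀ {y} → y ≢ a → newDeparture y ≡ departure π y
          newDeparture-other {y} y≢a rewrite dec-false (y ≟ a) y≢a = ≡.refl

          -- Dually, the tail of a descent goes on leaving by a drop, now to the new letter.
          newDeparture-drop : departure π a ≡ drop → ∀ y → newDeparture y ≡ departure π y
          newDeparture-drop p y with y ≟ a
          ... | yes ≡.refl = ≡.sym p
          ... | no  y≢a    = ≡.refl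

          departureTerm-source : ∀ {o} → departure π a ≡ o →
                     departureTerm a ≈ splitDeparture u (arrival π a) o * productExcept f a
          departureTerm-source p = *-congʳ (reflexive (≡.cong (splitDeparture u (arrival π a)) p))

          arrivalTerm-image : ∀ {o} → departure π a ≡ o →
                    arrivalTerm b ≈ splitArrival u o (departure π b) * productExcept f b
          arrivalTerm-image p = *-congʳ (reflexive (≡.cong (λ i → splitArrival u i (departure π b))
                                                 (≡.trans (arrival-image π a) p)))

          splitProduct-at : ∀ y {i o} → (∀ z → z ≢ y → newArrival z ≡ arrival π z) →
                          (∀ z → z ≢ y → newDeparture z ≡ departure π z) →
                          newArrival y ≡ i → newDeparture y ≡ o →
                          product (splitLetter a) ≈ weight u i o * productExcept f y
          splitProduct-at y p q r s = trans
            (product-update f (splitLetter a) y (λ z z≢y → reflexive (≡.cong₂ (weight u) (p z z≢y) (q z z≢y))))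
            (*-congʳ (reflexive (≡.cong₂ (weight u) r s)))

          -- Only the smaller end of the edge from a to b changes its type. The first summand
          -- accounts for it when this is a, or when the edge is a loop, the second when it is b; in
          -- each case the other summand is 0.
          splitProduct : product (splitLetter a) ≈ departureTerm a + arrivalTerm b
          splitProduct = byCases (departure π a) ≡.refl
            where
            byCases : ∀ o → departure π a ≡ o → product (splitLetter a) ≈ departureTerm a + arrivalTerm b
            byCases rise eq = begin
              product (splitLetter a)
                ≈⟨ splitProduct-at a (λ z _ → newArrival-rise eq z) (λ _ → newDeparture-other)
                     (newArrival-rise eq a) newDeparture-source ⟩
              weight u (arrival π a) drop * productExcept f a
                ≈⟨ +-identityʳ _ ⟨
              weight u (arrival π a) drop * productExcept f a + 0#
                ≈⟨ +-cong (departureTerm-source eq) (trans (arrivalTerm-image eq) (zeroˡ _)) ⟨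
              departureTerm a + arrivalTerm b ∎
            byCases drop eq = begin
              product (splitLetter a)
                ≈⟨ splitProduct-at b (λ _ → newArrival-other) (λ z _ → newDeparture-drop eq z)
                     newArrival-image (newDeparture-drop eq b) ⟩
              weight u rise (departure π b) * productExcept f b
                ≈⟨ +-identityˡ _ ⟨
              0# + weight u rise (departure π b) * productExcept f b
                ≈⟨ +-cong (trans (departureTerm-source eq) (trans
                             (*-congʳ (reflexive (splitDeparture-drop {u} (arrival π a)))) (zeroˡ _)))
                          (arrivalTerm-image eq) ⟨
              departureTerm a + arrivalTerm b ∎
            -- On a loop both steps change, but at the same letter a = b, which turns from a fixed
            -- point into a peak of weight 1.
            byCases level eq = begin
              product (splitLetter a)
                ≈⟨ splitProduct-at a
                     (λ z z≢a → newArrival-other (λ z≡b → z≢a (≡.trans z≡b (≡.sym a≡b))))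
                     (λ _ → newDeparture-other)
                     (≡.trans (≡.cong newArrival a≡b) newArrival-image) newDeparture-source ⟩
              1# * productExcept f a
                ≈⟨ +-identityʳ _ ⟨
              1# * productExcept f a + 0#
                ≈⟨ +-cong (trans (departureTerm-source eq) (*-congʳ (reflexive
                             (≡.cong (λ i → splitDeparture u i level) arrival-level))))
                          (trans (arrivalTerm-image eq) (zeroˡ _)) ⟨
              departureTerm a + arrivalTerm b ∎
              where
              a≡b : a ≡ b
              a≡b = step-level a b eq
              arrival-level : arrival π a ≡ level
              arrival-level = ≡.trans (≡.cong (arrival π) a≡b) (≡.trans (arrival-image π a) eq)

        -- The new letter is reached by a drop and left by a rise, so its own factor computes to
        -- that of a valley.
        W-ins-suc : ∀ a → W u (ins π (suc a)) ≈ (1# + u * u) * product (splitLetter a)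
        W-ins-suc a = *-congˡ (product-cong λ y →
          reflexive (≡.cong₂ (weight u) (arrival-ins π a y) (departure-ins π a y)))

        -- Collecting the contributions of the edges at the letter they change gives, by `δ-weight`,
        -- the derivative of the factor of that letter times the other factors. These are the terms
        -- of the Leibniz rule.
        sum-W-ins-suc : sum (λ a → W u (ins π (suc a))) ≈ δ (W u π)
        sum-W-ins-suc = begin
          sum (λ a → W u (ins π (suc a)))
            ≈⟨ sum-cong-≋ {n} (λ a → trans (W-ins-suc a) (*-congˡ (splitProduct a))) ⟩
          sum (λ a → (1# + u * u) * (departureTerm a + arrivalTerm (π ⟨$⟩ʳ a)))
            ≈⟨ *-distribˡ-sum (1# + u * u) (λ a → departureTerm a + arrivalTerm (π ⟨$⟩ʳ a)) ⟨
          (1# + u * u) * sum (λ a → departureTerm a + arrivalTerm (π ⟨$⟩ʳ a))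
            ≈⟨ *-congˡ (∑-distrib-+ departureTerm _) ⟩
          (1# + u * u) * (sum departureTerm + sum (λ a → arrivalTerm (π ⟨$⟩ʳ a)))
            -- Every letter is the head of exactly one edge, so a sum over tails a of a term at π(a)
            -- is a sum over all letters.
            ≈⟨ *-congˡ (+-congˡ (∑-permute arrivalTerm π)) ⟨
          (1# + u * u) * (sum departureTerm + sum arrivalTerm)
            ≈⟨ *-congˡ (∑-distrib-+ departureTerm arrivalTerm) ⟨
          (1# + u * u) * sum (λ y → departureTerm y + arrivalTerm y)
            ≈⟨ *-distribˡ-sum (1# + u * u) (λ y → departureTerm y + arrivalTerm y) ⟩
          sum (λ y → (1# + u * u) * (departureTerm y + arrivalTerm y))
            ≈⟨ sum-cong-≋ {n} (λ y → trans (*-congˡ (sym (distribʳ _ _ _)))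
                 (trans (sym (*-assoc _ _ _)) (*-congʳ (sym (δ-weight (arrival π y) (departure π y)))))) ⟩
          sum (λ y → δ (f y) * productExcept f y)
            ≈⟨ δ-product f ⟨
          δ (W u π) ∎

        W-ins-zero : W u (ins π zero) ≈ u * W u π
        W-ins-zero = *-congˡ (product-cong {n} λ y → refl)

      weightSum : ℕ → Carrier
      weightSum n = listSum (permutations n) (W u)

      weightSum-suc : ∀ n → weightSum (suc n) ≈ u * weightSum n + δ (weightSum n)
      weightSum-suc n = begin
        weightSum (suc n)
          ≈⟨ listSum-cartesianProductWith ins (permutations n) (allFin (suc n)) (W u) ⟩
        listSum (permutations n) (λ π → listSum (allFin (suc n)) (W u ∘ ins π))
          -- The first place in `allFin` makes the new letter a fixed point; the other n places are
          -- the edges.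
          ≈⟨ listSum-cong (permutations n) (λ π → trans (listSum-tabulate id (W u ∘ ins π))
               (+-cong (W-ins-zero π) (sum-W-ins-suc π))) ⟩
        listSum (permutations n) (λ π → u * W u π + δ (W u π))
          ≈⟨ listSum-+ (permutations n) _ _ ⟩
        listSum (permutations n) (λ π → u * W u π) + listSum (permutations n) (δ ∘ W u)
          ≈⟨ +-cong (listSum-*ˡ u (permutations n) (W u)) (sym (δ-listSum (permutations n) (W u))) ⟩
        u * weightSum n + δ (weightSum n) ∎

-- Formal power series as sequences of derivatives at 0

open import Defs
open import Data.Rational using (+-*-rawSemiring; ℚ; 0ℚ; 1ℚ; ½; -_; _+_; _*_; _/_; toℚᵘ)
open import Algebra.Definitions.RawSemiring +-*-rawSemiring using (_^_)
open import Data.Rational.Properties hiding (_≟_; _<?_)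
open import Data.Rational.Solver using () renaming (module +-*-Solver to ℚSolver)
open ≡ using (refl; sym; trans; cong; cong₂; subst)
open ≡.≡-Reasoning
open GroupProperties +-0-group using () renaming (⁻¹-involutive to neg-involutive)

infixl 7 _·_

-- The product for which the shift _∘ suc is a derivation.
_·_ : Series → Series → Series
(f · g) zero    = f 0 * g 0
(f · g) (suc n) = ((f ∘ suc) · g) n + (f · (g ∘ suc)) n

𝟘 : Series
𝟘 _ = 0ℚ

·-cong : ∀ {f f′ g g′} → f ≗ f′ → g ≗ g′ → f · g ≗ f′ · g′
·-cong p q zero    = cong₂ _*_ (p 0) (q 0)
·-cong p q (suc n) = cong₂ _+_ (·-cong (p ∘ suc) q n) (·-cong p (q ∘ suc) n)

·-comm : ∀ f g → f · g ≗ g · f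
·-comm f g zero    = *-comm (f 0) (g 0)
·-comm f g (suc n) =
  trans (cong₂ _+_ (·-comm (f ∘ suc) g n) (·-comm f (g ∘ suc) n)) (+-comm ((g · (f ∘ suc)) n) _)

+-interchange : ∀ a b c d → (a + b) + (c + d) ≡ (a + c) + (b + d)
+-interchange = solve 4 (λ a b c d → (a :+ b) :+ (c :+ d) := (a :+ c) :+ (b :+ d)) refl
  where open ℚSolver

·-distribʳ : ∀ h f g → (f ⊕ g) · h ≗ (f · h) ⊕ (g · h)
·-distribʳ h f g zero    = *-distribʳ-+ (h 0) (f 0) (g 0)
·-distribʳ h f g (suc n) =
  trans (cong₂ _+_ (·-distribʳ h (f ∘ suc) (g ∘ suc) n) (·-distribʳ (h ∘ suc) f g n))
        (+-interchange (((f ∘ suc) · h) n) _ _ _)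

·-distribˡ : ∀ h f g → h · (f ⊕ g) ≗ (h · f) ⊕ (h · g)
·-distribˡ h f g n = begin
  (h · (f ⊕ g)) n        ≡⟨ ·-comm h (f ⊕ g) n ⟩
  ((f ⊕ g) · h) n        ≡⟨ ·-distribʳ h f g n ⟩
  (f · h) n + (g · h) n  ≡⟨ cong₂ _+_ (·-comm f h n) (·-comm g h n) ⟩
  (h · f) n + (h · g) n  ∎

·-zeroˡ : ∀ f → 𝟘 · f ≗ 𝟘
·-zeroˡ f zero    = *-zeroˡ (f 0)
·-zeroˡ f (suc n) = cong₂ _+_ (·-zeroˡ f n) (·-zeroˡ (f ∘ suc) n)

·-identityˡ : ∀ f → 𝟙 · f ≗ f
·-identityˡ f zero    = *-identityˡ (f 0)
·-identityˡ f (suc n) =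
  trans (cong₂ _+_ (·-zeroˡ f n) (·-identityˡ (f ∘ suc) n)) (+-identityˡ _)

·-assoc : ∀ f g h → (f · g) · h ≗ f · (g · h)
·-assoc f g h zero    = *-assoc (f 0) (g 0) (h 0)
·-assoc f g h (suc n) = begin
  (((f ∘ suc) · g ⊕ f · (g ∘ suc)) · h) n + ((f · g) · (h ∘ suc)) n
    ≡⟨ cong₂ _+_ (·-distribʳ h _ _ n) (·-assoc f g (h ∘ suc) n) ⟩
  (((f ∘ suc) · g) · h) n + ((f · (g ∘ suc)) · h) n + (f · (g · (h ∘ suc))) n
    ≡⟨ cong (_+ (f · (g · (h ∘ suc))) n) (cong₂ _+_ (·-assoc (f ∘ suc) g h n) (·-assoc f (g ∘ suc) h n)) ⟩
  ((f ∘ suc) · (g · h)) n + (f · ((g ∘ suc) · h)) n + (f · (g · (h ∘ suc))) n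
    ≡⟨ +-assoc (((f ∘ suc) · (g · h)) n) _ _ ⟩
  ((f ∘ suc) · (g · h)) n + ((f · ((g ∘ suc) · h)) n + (f · (g · (h ∘ suc))) n)
    ≡⟨ cong (λ z → ((f ∘ suc) · (g · h)) n + z) (·-distribˡ f _ _ n) ⟨
  (f · (g · h)) (suc n) ∎

-- The ring of Hurwitz series: sequences multiplied like exponential generating functions. The shift
-- plays d/dx, and the weights are taken here with u = tan x.
hurwitzRing : CommutativeRing 0ℓ 0ℓ
hurwitzRing = record
  { Carrier = Series
  ; _≈_     = _≗_
  ; _+_     = _⊕_
  ; _*_     = _·_
  ; -_      = λ f n → - f n
  ; 0#      = 𝟘
  ; 1#      = 𝟙
  ; isCommutativeRing = record
    { isRing = record
      { +-isAbelianGroup = Pointwise.isAbelianGroup ℕ +-0-isAbelianGroup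
      ; *-cong     = ·-cong
      ; *-assoc    = ·-assoc
      ; *-identity = ·-identityˡ , λ f n → trans (·-comm f 𝟙 n) (·-identityˡ f n)
      ; distrib    = ·-distribˡ , ·-distribʳ
      }
    ; *-comm = ·-comm
    }
  }

-- From ordinary coefficients to derivatives at 0

ℕ→ℚ : ℕ → ℚ
ℕ→ℚ n = ℤ.+ n / 1

ℕ→ℚ-+ : ∀ m n → ℕ→ℚ (m ℕ.+ n) ≡ ℕ→ℚ m + ℕ→ℚ n
ℕ→ℚ-+ m n = toℚᵘ-injective (begin′
  toℚᵘ (ℕ→ℚ (m ℕ.+ n))
    ≈⟨ toℚᵘ-fromℚᵘ _ ⟩
  ℚᵘ.mkℚᵘ (ℤ.+ (m ℕ.+ n)) 0
    ≈⟨ ℚᵘ.*≡* (cong (ℤ._* ℤ.+ 1)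
         (sym (cong₂ ℤ._+_ (ℤ.*-identityʳ (ℤ.+ m)) (ℤ.*-identityʳ (ℤ.+ n))))) ⟩
  ℚᵘ.mkℚᵘ (ℤ.+ m) 0 ℚᵘ.+ ℚᵘ.mkℚᵘ (ℤ.+ n) 0
    ≈⟨ ℚᵘ.+-cong (toℚᵘ-fromℚᵘ (ℚᵘ.mkℚᵘ (ℤ.+ m) 0)) (toℚᵘ-fromℚᵘ (ℚᵘ.mkℚᵘ (ℤ.+ n) 0)) ⟨
  toℚᵘ (ℕ→ℚ m) ℚᵘ.+ toℚᵘ (ℕ→ℚ n)
    ≈⟨ toℚᵘ-homo-+ (ℕ→ℚ m) (ℕ→ℚ n) ⟨
  toℚᵘ (ℕ→ℚ m + ℕ→ℚ n) ∎′)
  where open ℚᵘ.≃-Reasoning renaming (begin_ to begin′_; _∎ to _∎′)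

ℕ→ℚ-suc : ∀ n → ℕ→ℚ (suc n) ≡ 1ℚ + ℕ→ℚ n
ℕ→ℚ-suc n = ℕ→ℚ-+ 1 n

ℕ→ℚ-* : ∀ m n → ℕ→ℚ (m ℕ.* n) ≡ ℕ→ℚ m * ℕ→ℚ n
ℕ→ℚ-* zero    n = sym (*-zeroˡ (ℕ→ℚ n))
ℕ→ℚ-* (suc m) n = begin
  ℕ→ℚ (n ℕ.+ m ℕ.* n)          ≡⟨ ℕ→ℚ-+ n (m ℕ.* n) ⟩
  ℕ→ℚ n + ℕ→ℚ (m ℕ.* n)        ≡⟨ cong₂ _+_ (sym (*-identityˡ (ℕ→ℚ n))) (ℕ→ℚ-* m n) ⟩
  1ℚ * ℕ→ℚ n + ℕ→ℚ m * ℕ→ℚ n   ≡⟨ *-distribʳ-+ (ℕ→ℚ n) 1ℚ (ℕ→ℚ m) ⟨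
  (1ℚ + ℕ→ℚ m) * ℕ→ℚ n         ≡⟨ cong (_* ℕ→ℚ n) (ℕ→ℚ-suc m) ⟨
  ℕ→ℚ (suc m) * ℕ→ℚ n          ∎

⊛-cong : ∀ {f f′ g g′} → f ≗ f′ → g ≗ g′ → f ⊛ g ≗ f′ ⊛ g′
⊛-cong p q zero    = cong (_+ 0ℚ) (cong₂ _*_ (p 0) (q 0))
⊛-cong p q (suc n) = cong₂ _+_ (cong₂ _*_ (p 0) (q (suc n))) (⊛-cong (p ∘ suc) q n)

⊛-distribʳ : ∀ h f g → (f ⊕ g) ⊛ h ≗ (f ⊛ h) ⊕ (g ⊛ h)
⊛-distribʳ h f g zero    =
  solve 3 (λ a b c → (a :+ b) :* c :+ con 0ℚ := (a :* c :+ con 0ℚ) :+ (b :* c :+ con 0ℚ))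
    refl (f 0) (g 0) (h 0)
  where open ℚSolver
⊛-distribʳ h f g (suc n) =
  trans (cong₂ _+_ (*-distribʳ-+ (h (suc n)) (f 0) (g 0)) (⊛-distribʳ h (f ∘ suc) (g ∘ suc) n))
        (+-interchange (f 0 * h (suc n)) _ _ _)

-- On ordinary coefficients, `θ` is x d/dx and `∂` is d/dx. The Leibniz rule comes first for `θ`,
-- which does not shift the index.
θ ∂ : Series → Series
θ f n = ℕ→ℚ n * f n
∂ f n = θ f (suc n)

θ-suc : ∀ f → ∂ f ≗ (f ∘ suc) ⊕ θ (f ∘ suc)
θ-suc f n = begin
  ℕ→ℚ (suc n) * f (suc n)                  ≡⟨ cong (_* f (suc n)) (ℕ→ℚ-suc n) ⟩
  (1ℚ + ℕ→ℚ n) * f (suc n)                 ≡⟨ *-distribʳ-+ (f (suc n)) 1ℚ (ℕ→ℚ n) ⟩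
  1ℚ * f (suc n) + ℕ→ℚ n * f (suc n)       ≡⟨ cong (_+ θ (f ∘ suc) n) (*-identityˡ (f (suc n))) ⟩
  f (suc n) + ℕ→ℚ n * f (suc n)            ∎

-- Induction along the recursion of `⊛` in its left factor. By `θ-suc`, shifting `θ f` yields one
-- extra copy of the shifted series; it accounts for the extra `P` that 1 + n leaves over n.
θ-⊛ : ∀ f g → θ (f ⊛ g) ≗ (θ f ⊛ g) ⊕ (f ⊛ θ g)
θ-⊛ f g zero    =
  solve 2 (λ a b → con 0ℚ :* (a :* b :+ con 0ℚ)
             := (con 0ℚ :* a :* b :+ con 0ℚ) :+ (a :* (con 0ℚ :* b) :+ con 0ℚ))
    refl (f 0) (g 0)
  where open ℚSolver
θ-⊛ f g (suc n) = begin
  N′ * (f 0 * g (suc n) + P)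
    ≡⟨ cong (_* (f 0 * g (suc n) + P)) (ℕ→ℚ-suc n) ⟩
  (1ℚ + N) * (f 0 * g (suc n) + P)
    ≡⟨ solve 4 (λ n a b p → (con 1ℚ :+ n) :* (a :* b :+ p)
                  := a :* ((con 1ℚ :+ n) :* b) :+ (p :+ n :* p))
         refl N (f 0) (g (suc n)) P ⟩
  f 0 * ((1ℚ + N) * g (suc n)) + (P + N * P)
    ≡⟨ cong₂ (λ m z → f 0 * (m * g (suc n)) + (P + z)) (sym (ℕ→ℚ-suc n)) (θ-⊛ (f ∘ suc) g n) ⟩
  f 0 * (N′ * g (suc n)) + (P + (Q + R))
    ≡⟨ solve 6 (λ a b c p q r → a :* b :+ (p :+ (q :+ r))
                  := (con 0ℚ :* a :* c :+ (p :+ q)) :+ (a :* b :+ r))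
         refl (f 0) (N′ * g (suc n)) (g (suc n)) P Q R ⟩
  (0ℚ * f 0 * g (suc n) + (P + Q)) + (f 0 * (N′ * g (suc n)) + R)
    ≡⟨ cong (λ z → (0ℚ * f 0 * g (suc n) + z) + (f 0 * (N′ * g (suc n)) + R))
         (trans (⊛-cong {g = g} (θ-suc f) (λ _ → refl) n)
                (⊛-distribʳ g (f ∘ suc) (θ (f ∘ suc)) n)) ⟨
  ((θ f ⊛ g) ⊕ (f ⊛ θ g)) (suc n) ∎
  where
  open ℚSolver
  N = ℕ→ℚ n
  N′ = ℕ→ℚ (suc n)
  P = ((f ∘ suc) ⊛ g) n
  Q = (θ (f ∘ suc) ⊛ g) n
  R = ((f ∘ suc) ⊛ θ g) n

-- The rule for `θ` read one coefficient later: a series `θ f` has constant term 0, so the two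
-- boundary terms vanish.
∂-⊛ : ∀ f g → ∂ (f ⊛ g) ≗ (∂ f ⊛ g) ⊕ (f ⊛ ∂ g)
∂-⊛ f g n = trans (θ-⊛ f g (suc n)) (cong₂ _+_ left (right f n))
  where
  left : (θ f ⊛ g) (suc n) ≡ (∂ f ⊛ g) n
  left = solve 3 (λ a b c → con 0ℚ :* a :* b :+ c := c) refl (f 0) (g (suc n)) _
    where open ℚSolver
  right : ∀ f n → (f ⊛ θ g) (suc n) ≡ (f ⊛ ∂ g) n
  right f zero    = solve 4 (λ a b c d → a :* b :+ (c :* (con 0ℚ :* d) :+ con 0ℚ) := a :* b :+ con 0ℚ)
                      refl (f 0) (θ g 1) (f 1) (g 0)
    where open ℚSolver
  right f (suc n) = cong (λ z → f 0 * ∂ g (suc n) + z) (right (f ∘ suc) n)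

derivatives : Series → Series
derivatives f n = f n * ℕ→ℚ (n !)

derivatives-suc : ∀ f → derivatives f ∘ suc ≗ derivatives (∂ f)
derivatives-suc f n = begin
  f (suc n) * ℕ→ℚ (suc n ℕ.* n !)             ≡⟨ cong (f (suc n) *_) (ℕ→ℚ-* (suc n) (n !)) ⟩
  f (suc n) * (ℕ→ℚ (suc n) * ℕ→ℚ (n !))       ≡⟨ *-assoc (f (suc n)) _ _ ⟨
  f (suc n) * ℕ→ℚ (suc n) * ℕ→ℚ (n !)         ≡⟨ cong (_* ℕ→ℚ (n !)) (*-comm (f (suc n)) _) ⟩
  ℕ→ℚ (suc n) * f (suc n) * ℕ→ℚ (n !)         ∎

derivatives-cong : ∀ {f g} → f ≗ g → derivatives f ≗ derivatives g
derivatives-cong p n = cong (_* ℕ→ℚ (n !)) (p n)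

-- Both products obey the Leibniz rule, so induction on the order of the derivative suffices and no
-- binomial coefficients appear.
derivatives-⊛ : ∀ f g → derivatives (f ⊛ g) ≗ derivatives f · derivatives g
derivatives-⊛ f g zero    =
  solve 2 (λ a b → (a :* b :+ con 0ℚ) :* con 1ℚ := (a :* con 1ℚ) :* (b :* con 1ℚ)) refl (f 0) (g 0)
  where open ℚSolver
derivatives-⊛ f g (suc n) = begin
  derivatives (f ⊛ g) (suc n)
    ≡⟨ derivatives-suc (f ⊛ g) n ⟩
  ∂ (f ⊛ g) n * ℕ→ℚ (n !)
    ≡⟨ cong (_* ℕ→ℚ (n !)) (∂-⊛ f g n) ⟩
  ((∂ f ⊛ g) n + (f ⊛ ∂ g) n) * ℕ→ℚ (n !)
    ≡⟨ *-distribʳ-+ (ℕ→ℚ (n !)) ((∂ f ⊛ g) n) _ ⟩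
  derivatives (∂ f ⊛ g) n + derivatives (f ⊛ ∂ g) n
    ≡⟨ cong₂ _+_ (derivatives-⊛ (∂ f) g n) (derivatives-⊛ f (∂ g) n) ⟩
  (derivatives (∂ f) · derivatives g) n + (derivatives f · derivatives (∂ g)) n
    ≡⟨ cong₂ _+_ (·-cong {g = derivatives g} (derivatives-suc f) (λ _ → refl) n)
                 (·-cong {derivatives f} (λ _ → refl) (derivatives-suc g) n) ⟨
  (derivatives f · derivatives g) (suc n) ∎

1/n!*n! : ∀ n → 1/ n ! * ℕ→ℚ (n !) ≡ 1ℚ
1/n!*n! n = trans (*-comm (1/ n !) _) (m/1*1/m≡1 (n !) {{n ℕ.!≢0}})

derivatives-egf : ∀ a → derivatives (egf a) ≗ a
derivatives-egf a n = begin
  a n * 1/ n ! * ℕ→ℚ (n !)      ≡⟨ *-assoc (a n) _ _ ⟩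
  a n * (1/ n ! * ℕ→ℚ (n !))    ≡⟨ cong (a n *_) (1/n!*n! n) ⟩
  a n * 1ℚ                      ≡⟨ *-identityʳ (a n) ⟩
  a n                           ∎

derivatives-⊘-cos : ∀ f → derivatives (f ⊘ cos) · cos⁽_⁾0 ≗ derivatives f
derivatives-⊘-cos f n = begin
  (derivatives (f ⊘ cos) · cos⁽_⁾0) n
    ≡⟨ ·-cong {derivatives (f ⊘ cos)} (λ _ → refl) (derivatives-egf cos⁽_⁾0) n ⟨
  (derivatives (f ⊘ cos) · derivatives cos) n
    ≡⟨ derivatives-⊛ (f ⊘ cos) cos n ⟨
  derivatives ((f ⊘ cos) ⊛ cos) n
    ≡⟨ derivatives-cong (⊘-⊛ f cos) n ⟩
  derivatives f n ∎

-- Secant and tangent as quotients by cosine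

sec⁽_⁾0 tan⁽_⁾0 : ℕ → ℚ
sec⁽_⁾0 = derivatives sec
tan⁽_⁾0 = derivatives tan

derivatives-𝟙 : derivatives 𝟙 ≗ 𝟙
derivatives-𝟙 zero    = refl
derivatives-𝟙 (suc n) = *-zeroˡ (ℕ→ℚ (suc n !))

sec·cos : sec⁽_⁾0 · cos⁽_⁾0 ≗ 𝟙
sec·cos n = trans (derivatives-⊘-cos 𝟙 n) (derivatives-𝟙 n)

tan·cos : tan⁽_⁾0 · cos⁽_⁾0 ≗ sin⁽_⁾0
tan·cos n = trans (derivatives-⊘-cos sin n) (derivatives-egf sin⁽_⁾0 n)

open CommutativeRing hurwitzRing using () renaming
  (*-congˡ to ·-congˡ; *-congʳ to ·-congʳ; *-identityʳ to ·-identityʳ)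

-- Since cos is a unit with inverse sec, identities between quotients can be checked after clearing
-- the denominator.
·cos-cancel : ∀ {f g} → f · cos⁽_⁾0 ≗ g · cos⁽_⁾0 → f ≗ g
·cos-cancel {f} {g} p n = trans (sym (undo f n)) (trans (·-congʳ {sec⁽_⁾0} p n) (undo g n))
  where
  undo : ∀ f → f · cos⁽_⁾0 · sec⁽_⁾0 ≗ f
  undo f n = begin
    (f · cos⁽_⁾0 · sec⁽_⁾0) n    ≡⟨ ·-assoc f _ _ n ⟩
    (f · (cos⁽_⁾0 · sec⁽_⁾0)) n  ≡⟨ ·-congˡ {f} (·-comm cos⁽_⁾0 sec⁽_⁾0) n ⟩
    (f · (sec⁽_⁾0 · cos⁽_⁾0)) n  ≡⟨ ·-congˡ {f} sec·cos n ⟩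
    (f · 𝟙) n                    ≡⟨ ·-identityʳ f n ⟩
    f n                          ∎

-- Parity of secant and tangent

-- f(x) ↦ f(-x)
σ : Series → Series
σ f zero    = f 0
σ f (suc n) = - σ (f ∘ suc) n

σ-cong : ∀ {f g} → f ≗ g → σ f ≗ σ g
σ-cong p zero    = p 0
σ-cong p (suc n) = cong -_ (σ-cong (p ∘ suc) n)

σ-⊕ : ∀ f g → σ (f ⊕ g) ≗ σ f ⊕ σ g
σ-⊕ f g zero    = refl
σ-⊕ f g (suc n) = trans (cong -_ (σ-⊕ (f ∘ suc) (g ∘ suc) n)) (neg-distrib-+ (σ (f ∘ suc) n) _)

σ-neg : ∀ f → σ (λ n → - f n) ≗ (λ n → - σ f n)
σ-neg f zero    = refl
σ-neg f (suc n) = cong -_ (σ-neg (f ∘ suc) n)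

neg-·ˡ : ∀ f g → (λ n → - f n) · g ≗ (λ n → - (f · g) n)
neg-·ˡ f g zero    = sym (neg-distribˡ-* (f 0) (g 0))
neg-·ˡ f g (suc n) =
  trans (cong₂ _+_ (neg-·ˡ (f ∘ suc) g n) (neg-·ˡ f (g ∘ suc) n)) (sym (neg-distrib-+ (((f ∘ suc) · g) n) _))

neg-·ʳ : ∀ f g → f · (λ n → - g n) ≗ (λ n → - (f · g) n)
neg-·ʳ f g n = trans (·-comm f _ n) (trans (neg-·ˡ g f n) (cong -_ (·-comm g f n)))

σ-· : ∀ f g → σ (f · g) ≗ σ f · σ g
σ-· f g zero    = refl
σ-· f g (suc n) = begin
  - σ ((f ∘ suc) · g ⊕ f · (g ∘ suc)) n
    ≡⟨ cong -_ (σ-⊕ ((f ∘ suc) · g) (f · (g ∘ suc)) n) ⟩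
  - (σ ((f ∘ suc) · g) n + σ (f · (g ∘ suc)) n)
    ≡⟨ neg-distrib-+ (σ ((f ∘ suc) · g) n) _ ⟩
  - σ ((f ∘ suc) · g) n + - σ (f · (g ∘ suc)) n
    ≡⟨ cong₂ (λ x y → - x + - y) (σ-· (f ∘ suc) g n) (σ-· f (g ∘ suc) n) ⟩
  - (σ (f ∘ suc) · σ g) n + - (σ f · σ (g ∘ suc)) n
    ≡⟨ cong₂ _+_ (neg-·ˡ (σ (f ∘ suc)) (σ g) n) (neg-·ʳ (σ f) (σ (g ∘ suc)) n) ⟨
  (σ f · σ g) (suc n) ∎

-- Proved together with `σ-sin`, since differentiation exchanges cos and sin up to sign.
σ-cos : σ cos⁽_⁾0 ≗ cos⁽_⁾0
σ-sin : σ sin⁽_⁾0 ≗ (λ n → - sin⁽ n ⁾0)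
σ-cos zero    = refl
σ-cos (suc n) = cong -_ (trans (σ-neg sin⁽_⁾0 n) (trans (cong -_ (σ-sin n)) (neg-involutive _)))
σ-sin zero    = refl
σ-sin (suc n) = cong -_ (σ-cos n)

σ-𝟙 : σ 𝟙 ≗ 𝟙
σ-𝟙 zero    = refl
σ-𝟙 (suc n) = cong -_ (σ-𝟘 n)
  where
  σ-𝟘 : σ 𝟘 ≗ 𝟘
  σ-𝟘 zero    = refl
  σ-𝟘 (suc n) = cong -_ (σ-𝟘 n)

σ-·cos : ∀ f → σ f · cos⁽_⁾0 ≗ σ (f · cos⁽_⁾0)
σ-·cos f n = trans (·-congˡ {σ f} (sym ∘ σ-cos) n) (sym (σ-· f cos⁽_⁾0 n))

-- The substitution is multiplicative and fixes cos, so after clearing the denominator only the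
-- evenness of 1 is left.
σ-sec : σ sec⁽_⁾0 ≗ sec⁽_⁾0
σ-sec = ·cos-cancel λ n → begin
  (σ sec⁽_⁾0 · cos⁽_⁾0) n  ≡⟨ σ-·cos sec⁽_⁾0 n ⟩
  σ (sec⁽_⁾0 · cos⁽_⁾0) n  ≡⟨ σ-cong sec·cos n ⟩
  σ 𝟙 n                    ≡⟨ σ-𝟙 n ⟩
  𝟙 n                      ≡⟨ sec·cos n ⟨
  (sec⁽_⁾0 · cos⁽_⁾0) n    ∎

-- As for sec, with the odd numerator sin.
σ-tan : σ tan⁽_⁾0 ≗ (λ n → - tan⁽ n ⁾0)
σ-tan = ·cos-cancel λ n → begin
  (σ tan⁽_⁾0 · cos⁽_⁾0) n               ≡⟨ σ-·cos tan⁽_⁾0 n ⟩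
  σ (tan⁽_⁾0 · cos⁽_⁾0) n               ≡⟨ σ-cong tan·cos n ⟩
  σ sin⁽_⁾0 n                           ≡⟨ σ-sin n ⟩
  - sin⁽ n ⁾0                           ≡⟨ cong -_ (tan·cos n) ⟨
  - (tan⁽_⁾0 · cos⁽_⁾0) n               ≡⟨ neg-·ˡ tan⁽_⁾0 cos⁽_⁾0 n ⟨
  ((λ n → - tan⁽ n ⁾0) · cos⁽_⁾0) n     ∎

σ-even : ∀ q f → σ f (q ℕ.* 2) ≡ f (q ℕ.* 2)
σ-even zero    f = refl
σ-even (suc q) f = trans (neg-involutive _) (σ-even q (λ n → f (suc (suc n))))

σ-odd : ∀ q f → σ f (suc (q ℕ.* 2)) ≡ - f (suc (q ℕ.* 2))
σ-odd q f = cong -_ (σ-even q (f ∘ suc))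

x≡-x⇒x≡0 : ∀ {x} → x ≡ - x → x ≡ 0ℚ
x≡-x⇒x≡0 {x} p = begin
  x              ≡⟨ solve 1 (λ x → x := con ½ :* (x :+ x)) refl x ⟩
  ½ * (x + x)    ≡⟨ cong (λ y → ½ * (x + y)) p ⟩
  ½ * (x + - x)  ≡⟨ cong (½ *_) (+-inverseʳ x) ⟩
  ½ * 0ℚ         ≡⟨⟩
  0ℚ             ∎
  where open ℚSolver

sec-odd : ∀ q → sec⁽ suc (q ℕ.* 2) ⁾0 ≡ 0ℚ
sec-odd q = x≡-x⇒x≡0 (trans (sym (σ-sec (suc (q ℕ.* 2)))) (σ-odd q sec⁽_⁾0))

tan-even : ∀ q → tan⁽ q ℕ.* 2 ⁾0 ≡ 0ℚ
tan-even q = x≡-x⇒x≡0 (trans (sym (σ-even q tan⁽_⁾0)) (σ-tan (q ℕ.* 2)))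

-- Derangements among the inserted permutations

-- Permutations are compared by their values, the equality under which insertion is injective and
-- the enumeration has no repetitions.
permutationSetoid : ℕ → Setoid 0ℓ 0ℓ
permutationSetoid n = record
  { Carrier       = Permutation′ n
  ; _≈_           = Perm._≈_
  ; isEquivalence = record
    { refl  = λ _ → refl
    ; sym   = λ p i → sym (p i)
    ; trans = λ p q i → trans (p i) (q i)
    }
  }

transpose-0-source : ∀ {n} (k : Fin (suc n)) → transpose zero k ⟨$⟩ʳ k ≡ zero
transpose-0-source zero = refl
transpose-0-source (suc a) with a ≟ a
... | yes _   = refl
... | no  a≢a = contradiction refl a≢a

ins-source : ∀ {n} (π : Permutation′ n) k → ins π k ⟨$⟩ʳ k ≡ zero
ins-source π k = cong (lift₀ π ⟨$⟩ʳ_) (transpose-0-source k)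

-- The place k is recovered as the preimage of the new letter 0; undoing the transposition then
-- recovers π.
ins-injective : ∀ {n} {π ρ : Permutation′ n} {k l} → ins π k Perm.≈ ins ρ l → π Perm.≈ ρ × k ≡ l
ins-injective {π = π} {ρ} {k} {l} p = π≈ρ , k≡l
  where
  k≡l : k ≡ l
  k≡l = begin
    k                                ≡⟨ inverseˡ (ins ρ l) ⟨
    ins ρ l ⟨$⟩ˡ (ins ρ l ⟨$⟩ʳ k)    ≡⟨ cong (ins ρ l ⟨$⟩ˡ_) (trans (sym (p k)) (ins-source π k)) ⟩
    ins ρ l ⟨$⟩ˡ zero                ≡⟨ cong (ins ρ l ⟨$⟩ˡ_) (ins-source ρ l) ⟨
    ins ρ l ⟨$⟩ˡ (ins ρ l ⟨$⟩ʳ l)    ≡⟨ inverseˡ (ins ρ l) ⟩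
    l                                ∎
  lifted : ∀ i → lift₀ π ⟨$⟩ʳ i ≡ lift₀ ρ ⟨$⟩ʳ i
  lifted i = begin
    lift₀ π ⟨$⟩ʳ i                                     ≡⟨ cong (lift₀ π ⟨$⟩ʳ_) (inverseʳ (transpose zero k)) ⟨
    ins π k ⟨$⟩ʳ (transpose k zero ⟨$⟩ʳ i)             ≡⟨ p (transpose k zero ⟨$⟩ʳ i) ⟩
    ins ρ l ⟨$⟩ʳ (transpose k zero ⟨$⟩ʳ i)             ≡⟨ cong (λ m → ins ρ l ⟨$⟩ʳ (transpose m zero ⟨$⟩ʳ i)) k≡l ⟩
    ins ρ l ⟨$⟩ʳ (transpose l zero ⟨$⟩ʳ i)             ≡⟨ cong (lift₀ ρ ⟨$⟩ʳ_) (inverseʳ (transpose zero l)) ⟩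
    lift₀ ρ ⟨$⟩ʳ i                                     ∎
  π≈ρ : π Perm.≈ ρ
  π≈ρ i = suc-injective (lifted (suc i))

-- With k the preimage of 0, undoing the transposition gives a permutation τ that fixes 0, and 0 can
-- be removed from it.
ins-surjective : ∀ {n} (ρ : Permutation′ (suc n)) → ∃₂ λ π k → ins π k Perm.≈ ρ
ins-surjective ρ = remove zero τ , k , λ i → begin
  lift₀ (remove zero τ) ⟨$⟩ʳ (transpose zero k ⟨$⟩ʳ i)    ≡⟨ lift₀-remove τ τ-0 _ ⟩
  τ ⟨$⟩ʳ (transpose zero k ⟨$⟩ʳ i)                        ≡⟨ cong (ρ ⟨$⟩ʳ_) (inverseʳ (transpose k zero)) ⟩
  ρ ⟨$⟩ʳ i                                                ∎
  where
  k = ρ ⟨$⟩ˡ zero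
  τ = transpose k zero ∘ₚ ρ
  τ-0 : τ ⟨$⟩ʳ zero ≡ zero
  τ-0 = trans (cong (ρ ⟨$⟩ʳ_) (trans (cong (transpose k zero ⟨$⟩ʳ_) (sym (transpose-0-source k)))
                                     (inverseʳ (transpose k zero))))
              (inverseʳ ρ)

ins-cong : ∀ {n} {π ρ : Permutation′ n} k → π Perm.≈ ρ → ins π k Perm.≈ ins ρ k
ins-cong {π = π} {ρ} k p i = Perm.lift₀-cong π ρ p _

permutations-complete : ∀ {n} (ρ : Permutation′ n) → ∃ λ π → π ∈ permutations n × π Perm.≈ ρ
permutations-complete {zero}  ρ = Perm.id , here refl , λ ()
permutations-complete {suc n} ρ =
  let π , k , πk≈ρ    = ins-surjective ρ
      π′ , π′∈ , π′≈π = permutations-complete π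
  in ins π′ k , ∈-cartesianProductWith⁺ ins π′∈ (∈-allFin k) ,
     λ i → trans (ins-cong {π = π′} {π} k π′≈π i) (πk≈ρ i)

permutations-unique : ∀ n → SetoidUnique.Unique (permutationSetoid n) (permutations n)
permutations-unique zero    = [] ∷ []
permutations-unique (suc n) = SetoidUnique.cartesianProductWith⁺
  (permutationSetoid n) (≡.setoid (Fin (suc n))) (permutationSetoid (suc n)) ins
  (λ {w} {x} → ins-injective {π = w} {x}) (permutations-unique n) (Unique.allFin⁺ (suc n))

toWord : ∀ {n} → Permutation′ n → Word n
toWord π = Vec.tabulate (π ⟨$⟩ʳ_)

lookup-toWord : ∀ {n} (π : Permutation′ n) i → lookup (toWord π) i ≡ π ⟨$⟩ʳ i
lookup-toWord π = lookup∘tabulate (π ⟨$⟩ʳ_)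

permutationWords-unique : ∀ n → Unique (map toWord (permutations n))
permutationWords-unique n = SetoidUnique.map⁺ (permutationSetoid n) (≡.setoid (Word n))
  (λ {π} {ρ} p i → trans (sym (lookup-toWord π i)) (trans (cong (λ w → lookup w i) p) (lookup-toWord ρ i)))
  (permutations-unique n)

permutationWords-complete : ∀ {n} (w : Word n) → IsPermutation w → w ∈ map toWord (permutations n)
permutationWords-complete {n} w bij =
  let π , π∈ , π≈w = permutations-complete (⤖⇒↔ (mk⤖ bij))
  in subst (_∈ map toWord (permutations n))
           (trans (tabulate-cong π≈w) (tabulate∘lookup w)) (∈-map⁺ toWord π∈)

words-unique : ∀ {A : Set} {as : List A} → Unique as → ∀ k → Unique (words as k)
words-unique u zero    = [] ∷ []
words-unique u (suc k) = Unique.cartesianProductWith⁺ _∷_ ∷-injective u (words-unique u k)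

words-complete : ∀ {n k} (w : Vec (Fin n) k) → w ∈ words (allFin n) k
words-complete []      = here refl
words-complete (x ∷ w) = ∈-cartesianProductWith⁺ _∷_ (∈-allFin x) (words-complete w)

-- Two lists without repetitions and with the same members are rearrangements of each other.
derangements-↭ : ∀ n → derangements n ↭ filter isDerangement? (map toWord (permutations n))
derangements-↭ n = ∼bag⇒↭ (unique∧set⇒bag
  (Unique.filter⁺ isDerangement? (words-unique (Unique.allFin⁺ n) n))
  (Unique.filter⁺ isDerangement? (permutationWords-unique n))
  (λ {w} → mk⇔
    (λ w∈ → let d = proj₂ (∈-filter⁻ isDerangement? {xs = words (allFin n) n} w∈)
            in ∈-filter⁺ isDerangement? (permutationWords-complete w (proj₁ d)) d)
    (λ w∈ → let d = proj₂ (∈-filter⁻ isDerangement? {xs = map toWord (permutations n)} w∈)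
            in ∈-filter⁺ isDerangement? (words-complete w) d)))

toWord-isPermutation : ∀ {n} (π : Permutation′ n) → IsPermutation (toWord π)
toWord-isPermutation π =
  (λ {i} {j} p → Bijection.injective (↔⇒⤖ π) (trans (sym (lookup-toWord π i)) (trans p (lookup-toWord π j)))) ,
  (λ j → π ⟨$⟩ˡ j , λ { refl → trans (lookup-toWord π _) (inverseʳ π) })

-- Weights at u = 0 as signs

private
  -- The weights are used twice: over the rationals at u = 0 and over Hurwitz series at u = tan x.
  module ℚWeights = Weights +-*-commutativeRing
  module SeriesWeights = Weights hurwitzRing

open ℚWeights using (weight; letter; W; listSum; listSum-cong; listSum-map; productExcept; product-update)
open CommutativeMonoidSum *-1-commutativeMonoid using ()
  renaming (sum to product; sum-cong-≗ to product-cong; ∑-permute to product-permute)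

sum-↭ : ∀ {xs ys} → xs ↭ ys → sum xs ≡ sum ys
sum-↭ ↭.refl          = refl
sum-↭ (↭.prep x p)    = cong (x +_) (sum-↭ p)
sum-↭ (↭.swap {xs} {ys} x y p) = trans (sym (+-assoc x y (sum xs)))
  (trans (cong₂ _+_ (+-comm x y) (sum-↭ p)) (+-assoc y x (sum ys)))
sum-↭ (↭.trans p q)   = trans (sum-↭ p) (sum-↭ q)

isDrop : Step → Bool
isDrop drop = true
isDrop _    = false

<?-step : ∀ {n} (x y : Fin n) → does (y <? x) ≡ isDrop (step x y)
<?-step zero    zero    = refl
<?-step zero    (suc y) = refl
<?-step (suc x) zero    = refl
<?-step (suc x) (suc y) = <?-step x y

sign : Bool → ℚ
sign true  = - 1ℚ
sign false = 1ℚ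

-- At u = 0 the weights u + 1, u - 1, 1, 1 + u² become 1, -1, 1, 1, so only double descents carry a
-- sign.
sign-weight : ∀ i o → i ≢ level → o ≢ level → weight 0ℚ i o ≡ sign (isDrop i ∧ isDrop o)
sign-weight rise  rise  _ _ = refl
sign-weight rise  drop  _ _ = refl
sign-weight drop  rise  _ _ = refl
sign-weight drop  drop  _ _ = refl
sign-weight level _     p _ = contradiction refl p
sign-weight rise  level _ p = contradiction refl p
sign-weight drop  level _ p = contradiction refl p

sign-count : ∀ {A : Set} {P : A → Set} (P? : ∀ x → Dec (P x)) {n} (h : Fin n → A) →
             (- 1ℚ) ^ length (filter P? (List.tabulate h)) ≡ product (λ i → sign (does (P? (h i))))
sign-count P? {zero}  h = refl
sign-count P? {suc n} h with does (P? (h zero))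
... | true  = cong (- 1ℚ *_) (sign-count P? (h ∘ suc))
... | false = trans (sign-count P? (h ∘ suc)) (sym (*-identityˡ _))

isCyclicDoubleDescent-step : ∀ {n} (π : Permutation′ n) x →
  does (isCyclicDoubleDescent? (toWord π) x) ≡ isDrop (departure π x) ∧ isDrop (departure π (π ⟨$⟩ʳ x))
isCyclicDoubleDescent-step π x rewrite lookup-toWord π x | lookup-toWord π (π ⟨$⟩ʳ x) =
  cong₂ _∧_ (<?-step x (π ⟨$⟩ʳ x)) (<?-step (π ⟨$⟩ʳ x) _)

W-derangement : ∀ {n} (π : Permutation′ n) → (∀ x → π ⟨$⟩ʳ x ≢ x) →
                W 0ℚ π ≡ (- 1ℚ) ^ cddes (toWord π)
W-derangement π fixedPointFree = begin
  product (letter 0ℚ π)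
    -- A cyclic double descent is recorded by the position x of the letter π(x), and the edge into
    -- π(x) is the edge out of x. Hence the factors are reindexed by π.
    ≡⟨ product-permute (letter 0ℚ π) π ⟩
  product (λ x → letter 0ℚ π (π ⟨$⟩ʳ x))
    ≡⟨ product-cong (λ x → trans
         (cong (λ i → weight 0ℚ i (departure π (π ⟨$⟩ʳ x))) (arrival-image π x))
         (trans (sign-weight _ _ (departure-≢ x) (departure-≢ (π ⟨$⟩ʳ x)))
                (cong sign (sym (isCyclicDoubleDescent-step π x))))) ⟩
  product (λ x → sign (does (isCyclicDoubleDescent? (toWord π) x)))
    ≡⟨ sign-count (isCyclicDoubleDescent? (toWord π)) id ⟨
  (- 1ℚ) ^ cddes (toWord π) ∎
  where
  departure-≢ : ∀ x → departure π x ≢ level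
  departure-≢ x p = fixedPointFree x (sym (step-level x (π ⟨$⟩ʳ x) p))

W-fixedPoint : ∀ {n} (π : Permutation′ n) x → π ⟨$⟩ʳ x ≡ x → W 0ℚ π ≡ 0ℚ
W-fixedPoint π x p = begin
  product (letter 0ℚ π)
    ≡⟨ product-update (letter 0ℚ π) (letter 0ℚ π) x (λ _ _ → refl) ⟩
  letter 0ℚ π x * productExcept (letter 0ℚ π) x
    ≡⟨ cong (_* productExcept (letter 0ℚ π) x) (cong₂ (weight 0ℚ) arrival-level departure-level) ⟩
  0ℚ * productExcept (letter 0ℚ π) x
    ≡⟨ *-zeroˡ (productExcept (letter 0ℚ π) x) ⟩
  0ℚ ∎
  where
  departure-level : departure π x ≡ level
  departure-level = trans (cong (step x) p) (step-refl x)
  arrival-level : arrival π x ≡ level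
  arrival-level = trans (cong (arrival π) (sym p)) (trans (arrival-image π x) departure-level)

if-does : ∀ {P : Set} {x y z : ℚ} (P? : Dec P) → (P → z ≡ x) → (¬ P → z ≡ y) →
          (if does P? then x else y) ≡ z
if-does (yes p) f g = sym (f p)
if-does (no ¬p) f g = sym (g ¬p)

listSum-filter : ∀ {A : Set} {P : A → Set} (P? : ∀ x → Dec (P x)) f xs →
                 listSum (filter P? xs) f ≡ listSum xs (λ x → if does (P? x) then f x else 0ℚ)
listSum-filter P? f []       = refl
listSum-filter P? f (x ∷ xs) with does (P? x)
... | true  = cong (f x +_) (listSum-filter P? f xs)
... | false = trans (listSum-filter P? f xs) (sym (+-identityˡ _))

-- Permutations with a fixed point weigh 0, so they can be added to the sum over derangements.
D-listSum : ∀ n → D n (- 1ℚ) ≡ listSum (permutations n) (W 0ℚ)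
D-listSum n = begin
  listSum (derangements n) signed
    ≡⟨ sum-↭ (map⁺ signed (derangements-↭ n)) ⟩
  listSum (filter isDerangement? (map toWord (permutations n))) signed
    ≡⟨ listSum-filter isDerangement? signed (map toWord (permutations n)) ⟩
  listSum (map toWord (permutations n)) (λ w → if does (isDerangement? w) then signed w else 0ℚ)
    ≡⟨ listSum-map toWord (permutations n) _ ⟩
  listSum (permutations n) (λ π → if does (isDerangement? (toWord π)) then signed (toWord π) else 0ℚ)
    ≡⟨ listSum-cong (permutations n) (λ π →
         if-does (isDerangement? (toWord π)) (derangement π) (notDerangement π)) ⟩
  listSum (permutations n) (W 0ℚ) ∎
  where
  signed : Word n → ℚ
  signed w = (- 1ℚ) ^ cddes w
  derangement : ∀ π → IsDerangement (toWord π) → W 0ℚ π ≡ signed (toWord π)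
  derangement π (_ , d) = W-derangement π (λ x p → d x (trans (lookup-toWord π x) p))
  notDerangement : ∀ π → ¬ IsDerangement (toWord π) → W 0ℚ π ≡ 0ℚ
  notDerangement π ¬d with any? (λ x → π ⟨$⟩ʳ x ≟ x)
  ... | yes (x , p) = W-fixedPoint π x p
  ... | no ¬p = contradiction
    (toWord-isPermutation π , λ x q → ¬p (x , trans (sym (lookup-toWord π x)) q)) ¬d

-- Specialisation of the series weights at x = 0

weight-0 : ∀ i o → SeriesWeights.weight tan⁽_⁾0 i o 0 ≡ weight 0ℚ i o
weight-0 rise  rise  = refl
weight-0 drop  drop  = refl
weight-0 rise  drop  = refl
weight-0 drop  rise  = refl
weight-0 level level = refl
weight-0 level rise  = refl
weight-0 level drop  = refl
weight-0 rise  level = refl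
weight-0 drop  level = refl

open CommutativeMonoidSum (CommutativeRing.*-commutativeMonoid hurwitzRing) using ()
  renaming (sum to seriesProduct)

product-0 : ∀ {n} (f : Fin n → Series) → seriesProduct f 0 ≡ product (λ i → f i 0)
product-0 {zero}  f = refl
product-0 {suc n} f = cong (f zero 0 *_) (product-0 (f ∘ suc))

listSum-0 : ∀ {A : Set} (xs : List A) (f : A → Series) →
            SeriesWeights.listSum xs f 0 ≡ listSum xs (λ x → f x 0)
listSum-0 []       f = refl
listSum-0 (x ∷ xs) f = cong (f x 0 +_) (listSum-0 xs f)

-- Differential equations and the derivatives of secant

shift-isDerivation : IsDerivation hurwitzRing (_∘ suc)
shift-isDerivation = record
  { δ-cong = λ p n → p (suc n)
  ; δ-+    = λ _ _ _ → refl
  ; δ-*    = λ _ _ _ → refl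
  }

-- The product rule (f cos)' = f' cos - f sin, solved for f' cos.
suc-·cos : ∀ f n → ((f ∘ suc) · cos⁽_⁾0) n ≡ (f · cos⁽_⁾0) (suc n) + (f · sin⁽_⁾0) n
suc-·cos f n = begin
  x                        ≡⟨ +-identityʳ x ⟨
  x + 0ℚ                   ≡⟨ cong (x +_) (+-inverseˡ y) ⟨
  x + (- y + y)            ≡⟨ +-assoc x (- y) y ⟨
  x + - y + y              ≡⟨ cong (λ z → x + z + y) (neg-·ʳ f sin⁽_⁾0 n) ⟨
  (f · cos⁽_⁾0) (suc n) + y ∎
  where
  x = ((f ∘ suc) · cos⁽_⁾0) n
  y = (f · sin⁽_⁾0) n

·tan·cos : ∀ f → f · tan⁽_⁾0 · cos⁽_⁾0 ≗ f · sin⁽_⁾0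
·tan·cos f n = trans (·-assoc f tan⁽_⁾0 cos⁽_⁾0 n) (·-congˡ {f} tan·cos n)

sec-suc : sec⁽_⁾0 ∘ suc ≗ sec⁽_⁾0 · tan⁽_⁾0
sec-suc = ·cos-cancel λ n → begin
  ((sec⁽_⁾0 ∘ suc) · cos⁽_⁾0) n                            ≡⟨ suc-·cos sec⁽_⁾0 n ⟩
  (sec⁽_⁾0 · cos⁽_⁾0) (suc n) + (sec⁽_⁾0 · sin⁽_⁾0) n      ≡⟨ cong (_+ (sec⁽_⁾0 · sin⁽_⁾0) n) (sec·cos (suc n)) ⟩
  0ℚ + (sec⁽_⁾0 · sin⁽_⁾0) n                               ≡⟨ +-identityˡ _ ⟩
  (sec⁽_⁾0 · sin⁽_⁾0) n                                    ≡⟨ ·tan·cos sec⁽_⁾0 n ⟨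
  (sec⁽_⁾0 · tan⁽_⁾0 · cos⁽_⁾0) n                          ∎

tan-suc : tan⁽_⁾0 ∘ suc ≗ 𝟙 ⊕ tan⁽_⁾0 · tan⁽_⁾0
tan-suc = ·cos-cancel λ n → begin
  ((tan⁽_⁾0 ∘ suc) · cos⁽_⁾0) n                            ≡⟨ suc-·cos tan⁽_⁾0 n ⟩
  (tan⁽_⁾0 · cos⁽_⁾0) (suc n) + (tan⁽_⁾0 · sin⁽_⁾0) n      ≡⟨ cong (_+ (tan⁽_⁾0 · sin⁽_⁾0) n) (tan·cos (suc n)) ⟩
  cos⁽ n ⁾0 + (tan⁽_⁾0 · sin⁽_⁾0) n                        ≡⟨ cong₂ _+_ (·-identityˡ cos⁽_⁾0 n) (·tan·cos tan⁽_⁾0 n) ⟨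
  (𝟙 · cos⁽_⁾0) n + (tan⁽_⁾0 · tan⁽_⁾0 · cos⁽_⁾0) n        ≡⟨ ·-distribʳ cos⁽_⁾0 𝟙 (tan⁽_⁾0 · tan⁽_⁾0) n ⟨
  ((𝟙 ⊕ tan⁽_⁾0 · tan⁽_⁾0) · cos⁽_⁾0) n                    ∎

private
  totalSeries : ℕ → Series
  totalSeries = SeriesWeights.weightSum shift-isDerivation tan-suc

-- This is the identity of series sec⁽ⁿ⁾ = sec · Sₙ, compared at the k-th derivative. Keeping k
-- arbitrary lets the induction on n differentiate, that is, pass from k to k + 1.
sec-derivatives : ∀ n k → sec⁽ k ℕ.+ n ⁾0 ≡ (sec⁽_⁾0 · totalSeries n) k
sec-derivatives zero    k = begin
  sec⁽ k ℕ.+ 0 ⁾0      ≡⟨ cong sec⁽_⁾0 (ℕ.+-identityʳ k) ⟩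
  sec⁽ k ⁾0            ≡⟨ ·-identityʳ sec⁽_⁾0 k ⟨
  (sec⁽_⁾0 · 𝟙) k      ≡⟨ ·-congˡ {sec⁽_⁾0} (λ m → +-identityʳ (𝟙 m)) k ⟨
  (sec⁽_⁾0 · totalSeries 0) k    ∎
sec-derivatives (suc n) k = begin
  sec⁽ k ℕ.+ suc n ⁾0
    ≡⟨ cong sec⁽_⁾0 (ℕ.+-suc k n) ⟩
  sec⁽ suc k ℕ.+ n ⁾0
    -- By the definition of `·`, the coefficient at `suc k` is already the product rule applied to
    -- sec · Sₙ.
    ≡⟨ sec-derivatives n (suc k) ⟩
  ((sec⁽_⁾0 ∘ suc) · totalSeries n) k + (sec⁽_⁾0 · (totalSeries n ∘ suc)) k
    ≡⟨ cong (_+ (sec⁽_⁾0 · (totalSeries n ∘ suc)) k)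
         (trans (·-congʳ {totalSeries n} sec-suc k) (·-assoc sec⁽_⁾0 tan⁽_⁾0 (totalSeries n) k)) ⟩
  (sec⁽_⁾0 · (tan⁽_⁾0 · totalSeries n)) k + (sec⁽_⁾0 · (totalSeries n ∘ suc)) k
    ≡⟨ ·-distribˡ sec⁽_⁾0 (tan⁽_⁾0 · totalSeries n) (totalSeries n ∘ suc) k ⟨
  (sec⁽_⁾0 · (tan⁽_⁾0 · totalSeries n ⊕ totalSeries n ∘ suc)) k
    ≡⟨ ·-congˡ {sec⁽_⁾0} (SeriesWeights.weightSum-suc shift-isDerivation tan-suc n) k ⟨
  (sec⁽_⁾0 · totalSeries (suc n)) k ∎

sec⁽⁾0≡D : ∀ n → sec⁽ n ⁾0 ≡ D n (- 1ℚ)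
sec⁽⁾0≡D n = begin
  -- At k = 0 the product is one of constant terms, and sec 0 = 1.
  sec⁽ n ⁾0          ≡⟨ sec-derivatives n 0 ⟩
  1ℚ * totalSeries n 0  ≡⟨ *-identityˡ (totalSeries n 0) ⟩
  totalSeries n 0    ≡⟨ listSum-0 (permutations n) (SeriesWeights.W tan⁽_⁾0) ⟩
  listSum (permutations n) (λ π → SeriesWeights.W tan⁽_⁾0 π 0)
    ≡⟨ listSum-cong (permutations n) (λ π → trans
         (product-0 (SeriesWeights.letter tan⁽_⁾0 π))
         (product-cong (λ y → weight-0 (arrival π y) (departure π y)))) ⟩
  listSum (permutations n) (W 0ℚ)   ≡⟨ D-listSum n ⟨
  D n (- 1ℚ)         ∎

-- Even and odd cases and the generating function

even⊎odd : ∀ n → 2 ∣ n ⊎ ∃ λ q → n ≡ suc (q ℕ.* 2)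
even⊎odd zero    = inj₁ (divides 0 refl)
even⊎odd (suc n) with even⊎odd n
... | inj₁ (divides q n≡2q)   = inj₂ (q , cong suc n≡2q)
... | inj₂ (q , n≡2q+1) = inj₁ (divides (suc q) (cong suc n≡2q+1))

theorem16 : ((n : ℕ) → n ≥ 1 → (2 ∣ n → D n (- 1ℚ) ≡ E n) × (2 ∤ n → D n (- 1ℚ) ≡ 0ℚ))
    × (D-egf (- 1ℚ) ≗ sec)
theorem16 = (λ n _ → even n , odd n) , series
  where
  even : ∀ n → 2 ∣ n → D n (- 1ℚ) ≡ E n
  even n (divides q refl) = begin
    D n (- 1ℚ)                ≡⟨ sec⁽⁾0≡D n ⟨
    -- The tangent contributes nothing to E at even n, because tan is odd.
    sec⁽ n ⁾0                 ≡⟨ +-identityʳ _ ⟨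
    sec⁽ n ⁾0 + 0ℚ            ≡⟨ cong (sec⁽ n ⁾0 +_) (tan-even q) ⟨
    sec⁽ n ⁾0 + tan⁽ n ⁾0     ≡⟨ *-distribʳ-+ (ℕ→ℚ (n !)) (sec n) (tan n) ⟨
    E n                       ∎
  odd : ∀ n → 2 ∤ n → D n (- 1ℚ) ≡ 0ℚ
  odd n 2∤n with even⊎odd n
  ... | inj₁ 2∣n        = contradiction 2∣n 2∤n
  ... | inj₂ (q , refl) = trans (sym (sec⁽⁾0≡D n)) (sec-odd q)
  series : D-egf (- 1ℚ) ≗ sec
  -- The constant terms of `D-egf` and sec are both 1; every later coefficient comes from `D`.
  series zero      = refl
  series n@(suc _) = begin
    0ℚ + D n (- 1ℚ) * 1/ n !              ≡⟨ +-identityˡ _ ⟩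
    D n (- 1ℚ) * 1/ n !                   ≡⟨ cong (_* 1/ n !) (sec⁽⁾0≡D n) ⟨
    sec n * ℕ→ℚ (n !) * 1/ n !            ≡⟨ *-assoc (sec n) _ _ ⟩
    sec n * (ℕ→ℚ (n !) * 1/ n !)          ≡⟨ cong (sec n *_) (m/1*1/m≡1 (n !) {{n ℕ.!≢0}}) ⟩
    sec n * 1ℚ                            ≡⟨ *-identityʳ (sec n) ⟩
    sec n                                 ∎
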